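{- Every deterministic algorithm requires $\Omega(\log n)$ vertex evaluations in the worst case to find the sink of an $n$-dimensional realizable Matoušek-type USO.
   Context: All vectors and matrices are over $GF(2)$; $\oplus$ denotes xor. An orientation of the hypercube $\{0,1\}^n$ is given by an outmap $o:\{0,1\}^n\to\{0,1\}^n$, the edge $\{v,v\oplus e_i\}$ being directed away from $v$ iff $o(v)_i=1$. An $n$-dimensional Matoušek-type USO is an orientation $o(v)=M(v\oplus s)$ with $M=PAP^T$ for a permutation matrix $P$ and an invertible upper-triangular $A\in\{0,1\}^{n\times n}$, and $s\in\{0,1\}^n$ its unique sink. Its dimension influence graph is the directed graph on $[n]$ with edge $(i,j)$ iff $M_{j,i}=1$. A USO is realizable if it arises from the (Stickney–Watson) reduction of a non-degenerate P-matrix LCP instance to USO sink-finding; a Matoušek-type USO is realizable iff its dimension influence graph is the reflexive transitive closure of a branching (a forest of rooted trees with edges directed away from the roots). A sink-finding algorithm queries vertices $v$ and receives $o(v)$. -}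

module Defs where

open import Algebra.Bundles using (CommutativeRing)
open import Algebra.Bundles.Raw using (RawRing)
import Algebra.Definitions.RawMonoid as RawMonoidDefs
open import Data.Bool.Base using (Bool; true; false; _xor_; if_then_else_)
open import Data.Bool.Properties using (xor-∧-commutativeRing)
open import Data.Fin.Base as Fin using (Fin; zero; suc; toℕ; punchIn)
open import Data.Fin.Permutation using (Permutation′; _⟨$⟩ʳ_)
open import Data.Fin.Properties using () renaming (_≟_ to _≟ᶠ_)
open import Data.List.Base using (List; []; _∷_)
open import Data.Nat.Base as ℕ using (ℕ; zero; suc)
import Data.Nat.Properties as ℕₚ
open import Data.Product.Base using (∃-syntax; _×_; _,_)
open import Data.Rational.Base as ℚ using (ℚ; 0ℚ; 1ℚ; ½; ∣_∣)
import Data.Rational.Properties as ℚₚ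
open import Data.Rational.Solver using (module +-*-Solver)
open import Data.Vec.Base using (Vec; lookup; zipWith; replicate)
open import Function.Bundles using (_⇔_)
open import Level using (0ℓ)
open import Relation.Binary.PropositionalEquality
  using (_≡_; refl; sym; trans; cong; cong₂; subst)
open import Relation.Nullary using (¬_; does)

-- A real number is a Cauchy sequence of rationals, up to _≈ʳ_.

IsCauchy : (ℕ → ℚ) → Set
IsCauchy x = ∀ ε → 0ℚ ℚ.< ε →
  ∃[ N ] ∀ m n → N ℕ.≤ m → N ℕ.≤ n → ∣ x m ℚ.- x n ∣ ℚ.≤ ε

record ℝ : Set where
  constructor mkℝ
  field
    seq    : ℕ → ℚ
    cauchy : IsCauchy seq

open ℝ public

infix 4 _≈ʳ_ _<ʳ_

_≈ʳ_ : ℝ → ℝ → Set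
x ≈ʳ y = ∀ ε → 0ℚ ℚ.< ε →
  ∃[ N ] ∀ n → N ℕ.≤ n → ∣ seq x n ℚ.- seq y n ∣ ℚ.≤ ε

_<ʳ_ : ℝ → ℝ → Set
x <ʳ y = ∃[ ε ] 0ℚ ℚ.< ε ×
  (∃[ N ] ∀ n → N ℕ.≤ n → seq x n ℚ.+ ε ℚ.≤ seq y n)

private
  half>0 : ∀ {ε} → 0ℚ ℚ.< ε → 0ℚ ℚ.< ½ ℚ.* ε
  half>0 {ε} p = subst (ℚ._< ½ ℚ.* ε) (ℚₚ.*-zeroʳ ½) (ℚₚ.*-monoʳ-<-pos ½ p)

  halves : ∀ ε → ½ ℚ.* ε ℚ.+ ½ ℚ.* ε ≡ ε
  halves ε = trans (sym (ℚₚ.*-distribʳ-+ ε ½ ½)) (ℚₚ.*-identityˡ ε)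

  quotient : ∀ B ε → 0ℚ ℚ.< B → 0ℚ ℚ.< ε → ∃[ δ ] 0ℚ ℚ.< δ × B ℚ.* δ ≡ ε
  quotient B ε B>0 ε>0 = ℚ.1/ B ℚ.* ε , δ>0 , eq
    where
    instance
      B-pos : ℚ.Positive B
      B-pos = ℚ.positive B>0
      B≢0 : ℚ.NonZero B
      B≢0 = ℚₚ.pos⇒nonZero B
      1/B-pos : ℚ.Positive (ℚ.1/ B)
      1/B-pos = ℚₚ.1/pos⇒pos B
    δ>0 : 0ℚ ℚ.< ℚ.1/ B ℚ.* ε
    δ>0 = subst (ℚ._< ℚ.1/ B ℚ.* ε) (ℚₚ.*-zeroʳ (ℚ.1/ B)) (ℚₚ.*-monoʳ-<-pos (ℚ.1/ B) ε>0)
    eq : B ℚ.* (ℚ.1/ B ℚ.* ε) ≡ ε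
    eq = trans (sym (ℚₚ.*-assoc B (ℚ.1/ B) ε))
        (trans (cong (ℚ._* ε) (ℚₚ.*-inverseʳ B)) (ℚₚ.*-identityˡ ε))

  bounded : ∀ {x} → IsCauchy x →
    ∃[ B ] 0ℚ ℚ.< B × (∃[ N ] ∀ n → N ℕ.≤ n → ∣ x n ∣ ℚ.≤ B)
  bounded {x} cx with cx 1ℚ (ℚₚ.positive⁻¹ 1ℚ)
  ... | N , h = ∣ x N ∣ ℚ.+ 1ℚ , B>0 , N , bnd
    where
    open ℚₚ.≤-Reasoning
    B>0 : 0ℚ ℚ.< ∣ x N ∣ ℚ.+ 1ℚ
    B>0 = ℚₚ.+-mono-≤-< (ℚₚ.0≤∣p∣ (x N)) (ℚₚ.positive⁻¹ 1ℚ)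
    split : ∀ a b → a ≡ b ℚ.+ (a ℚ.- b)
    split = solve 2 (λ a b → a := b :+ (a :- b)) refl
      where open +-*-Solver
    bnd : ∀ n → N ℕ.≤ n → ∣ x n ∣ ℚ.≤ ∣ x N ∣ ℚ.+ 1ℚ
    bnd n N≤n = begin
      ∣ x n ∣                      ≡⟨ cong ∣_∣ (split (x n) (x N)) ⟩
      ∣ x N ℚ.+ (x n ℚ.- x N) ∣     ≤⟨ ℚₚ.∣p+q∣≤∣p∣+∣q∣ (x N) (x n ℚ.- x N) ⟩
      ∣ x N ∣ ℚ.+ ∣ x n ℚ.- x N ∣   ≤⟨ ℚₚ.+-monoʳ-≤ ∣ x N ∣ (h n N N≤n ℕₚ.≤-refl) ⟩
      ∣ x N ∣ ℚ.+ 1ℚ               ∎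

  *-mono-∣∣ : ∀ a b {A B} → ∣ a ∣ ℚ.≤ A → ∣ b ∣ ℚ.≤ B → ∣ a ℚ.* b ∣ ℚ.≤ A ℚ.* B
  *-mono-∣∣ a b {A} {B} p q = begin
    ∣ a ℚ.* b ∣      ≡⟨ ℚₚ.∣p*q∣≡∣p∣*∣q∣ a b ⟩
    ∣ a ∣ ℚ.* ∣ b ∣   ≤⟨ ℚₚ.*-monoˡ-≤-nonNeg ∣ a ∣ {{ℚ.nonNegative (ℚₚ.0≤∣p∣ a)}} q ⟩
    ∣ a ∣ ℚ.* B      ≤⟨ ℚₚ.*-monoʳ-≤-nonNeg B {{ℚ.nonNegative (ℚₚ.≤-trans (ℚₚ.0≤∣p∣ b) q)}} p ⟩
    A ℚ.* B         ∎
    where open ℚₚ.≤-Reasoning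

  const-cauchy : ∀ q → IsCauchy (λ _ → q)
  const-cauchy q ε ε>0 = 0 , λ _ _ _ _ →
    subst (λ z → ∣ z ∣ ℚ.≤ ε) (sym (ℚₚ.+-inverseʳ q)) (ℚₚ.<⇒≤ ε>0)

  neg-cauchy : ∀ {x} → IsCauchy x → IsCauchy (λ n → ℚ.- x n)
  neg-cauchy {x} cx ε ε>0 with cx ε ε>0
  ... | N , h = N , λ m n N≤m N≤n →
    subst (ℚ._≤ ε)
      (trans (sym (ℚₚ.∣-p∣≡∣p∣ (x m ℚ.- x n))) (cong ∣_∣ (ℚₚ.neg-distrib-+ (x m) (ℚ.- x n))))
      (h m n N≤m N≤n)

  +-cauchy : ∀ {x y} → IsCauchy x → IsCauchy y → IsCauchy (λ n → x n ℚ.+ y n)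
  +-cauchy {x} {y} cx cy ε ε>0 with cx (½ ℚ.* ε) (half>0 ε>0) | cy (½ ℚ.* ε) (half>0 ε>0)
  ... | N₁ , h₁ | N₂ , h₂ = N₁ ℕ.⊔ N₂ , bnd
    where
    open ℚₚ.≤-Reasoning
    split : ∀ a b c d → (a ℚ.+ b) ℚ.- (c ℚ.+ d) ≡ (a ℚ.- c) ℚ.+ (b ℚ.- d)
    split = solve 4 (λ a b c d → (a :+ b) :- (c :+ d) := (a :- c) :+ (b :- d)) refl
      where open +-*-Solver
    bnd : ∀ m n → N₁ ℕ.⊔ N₂ ℕ.≤ m → N₁ ℕ.⊔ N₂ ℕ.≤ n →
          ∣ (x m ℚ.+ y m) ℚ.- (x n ℚ.+ y n) ∣ ℚ.≤ ε
    bnd m n p q = begin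
      ∣ (x m ℚ.+ y m) ℚ.- (x n ℚ.+ y n) ∣
        ≡⟨ cong ∣_∣ (split (x m) (y m) (x n) (y n)) ⟩
      ∣ (x m ℚ.- x n) ℚ.+ (y m ℚ.- y n) ∣
        ≤⟨ ℚₚ.∣p+q∣≤∣p∣+∣q∣ (x m ℚ.- x n) (y m ℚ.- y n) ⟩
      ∣ x m ℚ.- x n ∣ ℚ.+ ∣ y m ℚ.- y n ∣
        ≤⟨ ℚₚ.+-mono-≤ (h₁ m n (ℕₚ.m⊔n≤o⇒m≤o N₁ N₂ p) (ℕₚ.m⊔n≤o⇒m≤o N₁ N₂ q))
                       (h₂ m n (ℕₚ.m⊔n≤o⇒n≤o N₁ N₂ p) (ℕₚ.m⊔n≤o⇒n≤o N₁ N₂ q)) ⟩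
      ½ ℚ.* ε ℚ.+ ½ ℚ.* ε
        ≡⟨ halves ε ⟩
      ε ∎

  product-bound : ∀ a b c d {A B δ η} →
    ∣ a ∣ ℚ.≤ A → ∣ b ℚ.- d ∣ ℚ.≤ δ → ∣ d ∣ ℚ.≤ B → ∣ a ℚ.- c ∣ ℚ.≤ η →
    ∣ a ℚ.* b ℚ.- c ℚ.* d ∣ ℚ.≤ A ℚ.* δ ℚ.+ B ℚ.* η
  product-bound a b c d {A} {B} {δ} {η} a≤A b-d≤δ d≤B a-c≤η = begin
    ∣ a ℚ.* b ℚ.- c ℚ.* d ∣
      ≡⟨ cong ∣_∣ (split a b c d) ⟩
    ∣ a ℚ.* (b ℚ.- d) ℚ.+ d ℚ.* (a ℚ.- c) ∣
      ≤⟨ ℚₚ.∣p+q∣≤∣p∣+∣q∣ (a ℚ.* (b ℚ.- d)) (d ℚ.* (a ℚ.- c)) ⟩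
    ∣ a ℚ.* (b ℚ.- d) ∣ ℚ.+ ∣ d ℚ.* (a ℚ.- c) ∣
      ≤⟨ ℚₚ.+-mono-≤ (*-mono-∣∣ a (b ℚ.- d) a≤A b-d≤δ) (*-mono-∣∣ d (a ℚ.- c) d≤B a-c≤η) ⟩
    A ℚ.* δ ℚ.+ B ℚ.* η ∎
    where
    open ℚₚ.≤-Reasoning
    split : ∀ a b c d → a ℚ.* b ℚ.- c ℚ.* d ≡ a ℚ.* (b ℚ.- d) ℚ.+ d ℚ.* (a ℚ.- c)
    split = solve 4 (λ a b c d → a :* b :- c :* d := a :* (b :- d) :+ d :* (a :- c)) refl
      where open +-*-Solver

  *-cauchy : ∀ {x y} → IsCauchy x → IsCauchy y → IsCauchy (λ n → x n ℚ.* y n)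
  *-cauchy {x} {y} cx cy ε ε>0 =
    let A , A>0 , K₁ , b₁ = bounded {x} cx
        B , B>0 , K₂ , b₂ = bounded {y} cy
        δ , δ>0 , Aδ≡ε/2 = quotient A (½ ℚ.* ε) A>0 (half>0 ε>0)
        η , η>0 , Bη≡ε/2 = quotient B (½ ℚ.* ε) B>0 (half>0 ε>0)
        N₁ , h₁ = cx η η>0
        N₂ , h₂ = cy δ δ>0
        K = K₁ ℕ.⊔ K₂
        N = N₁ ℕ.⊔ N₂
    in K ℕ.⊔ N , λ m n p q →
      let K≤m = ℕₚ.m⊔n≤o⇒m≤o K N p
          N≤m = ℕₚ.m⊔n≤o⇒n≤o K N p
          K≤n = ℕₚ.m⊔n≤o⇒m≤o K N q
          N≤n = ℕₚ.m⊔n≤o⇒n≤o K N q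
      in subst (∣ x m ℚ.* y m ℚ.- x n ℚ.* y n ∣ ℚ.≤_)
           (trans (cong₂ ℚ._+_ Aδ≡ε/2 Bη≡ε/2) (halves ε))
           (product-bound (x m) (y m) (x n) (y n)
             (b₁ m (ℕₚ.m⊔n≤o⇒m≤o K₁ K₂ K≤m))
             (h₂ m n (ℕₚ.m⊔n≤o⇒n≤o N₁ N₂ N≤m) (ℕₚ.m⊔n≤o⇒n≤o N₁ N₂ N≤n))
             (b₂ n (ℕₚ.m⊔n≤o⇒n≤o K₁ K₂ K≤n))
             (h₁ m n (ℕₚ.m⊔n≤o⇒m≤o N₁ N₂ N≤m) (ℕₚ.m⊔n≤o⇒m≤o N₁ N₂ N≤n)))

fromℚ : ℚ → ℝ
fromℚ q = mkℝ (λ _ → q) (const-cauchy q)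

infixl 6 _+ʳ_
infixl 7 _*ʳ_
infix  8 -ʳ_

_+ʳ_ : ℝ → ℝ → ℝ
mkℝ x cx +ʳ mkℝ y cy = mkℝ (λ n → x n ℚ.+ y n) (+-cauchy {x} {y} cx cy)

_*ʳ_ : ℝ → ℝ → ℝ
mkℝ x cx *ʳ mkℝ y cy = mkℝ (λ n → x n ℚ.* y n) (*-cauchy {x} {y} cx cy)

-ʳ_ : ℝ → ℝ
-ʳ mkℝ x cx = mkℝ (λ n → ℚ.- x n) (neg-cauchy {x} cx)

ℝ-rawRing : RawRing 0ℓ 0ℓ
ℝ-rawRing = record
  { Carrier = ℝ
  ; _≈_     = _≈ʳ_
  ; _+_     = _+ʳ_
  ; _*_     = _*ʳ_
  ; -_      = -ʳ_
  ; 0#      = fromℚ 0ℚ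
  ; 1#      = fromℚ 1ℚ
  }

module Matrices {c ℓ} (R : RawRing c ℓ) where

  open RawRing R
  open RawMonoidDefs +-rawMonoid using (sum)

  infixl 7 _*ᴹ_
  infixr 7 _*ⱽ_
  infix  4 _≈ᴹ_
  infix  8 _ᵀ

  Matrix : ℕ → ℕ → Set c
  Matrix m n = Fin m → Fin n → Carrier

  _≈ᴹ_ : ∀ {m n} → Matrix m n → Matrix m n → Set ℓ
  A ≈ᴹ B = ∀ i j → A i j ≈ B i j

  _*ᴹ_ : ∀ {m n p} → Matrix m n → Matrix n p → Matrix m p
  (A *ᴹ B) i j = sum λ k → A i k * B k j

  _*ⱽ_ : ∀ {m n} → Matrix m n → (Fin n → Carrier) → (Fin m → Carrier)
  (A *ⱽ x) i = sum λ k → A i k * x k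

  _ᵀ : ∀ {m n} → Matrix m n → Matrix n m
  (A ᵀ) i j = A j i

  identity : ∀ n → Matrix n n
  identity n i j = if does (i ≟ᶠ j) then 1# else 0#

  permutationMatrix : ∀ {n} → Permutation′ n → Matrix n n
  permutationMatrix {n} π i j = identity n (π ⟨$⟩ʳ i) j

  UpperTriangular : ∀ {n} → Matrix n n → Set ℓ
  UpperTriangular A = ∀ i j → j Fin.< i → A i j ≈ 0#

  Invertible : ∀ {n} → Matrix n n → Set _
  Invertible {n} A = ∃[ B ] (A *ᴹ B ≈ᴹ identity n) × (B *ᴹ A ≈ᴹ identity n)

  signed : ℕ → Carrier → Carrier
  signed zero    x = x
  signed (suc k) x = - signed k x

  -- Laplace expansion along the first row.
  det : ∀ {n} → Matrix n n → Carrier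
  det {zero}  A = 1#
  det {suc n} A =
    sum λ j → signed (toℕ j) (A zero j * det (λ i k → A (suc i) (punchIn j k)))

module GF2 = Matrices (CommutativeRing.rawRing xor-∧-commutativeRing)
module Real = Matrices ℝ-rawRing

Vertex : ℕ → Set
Vertex n = Vec Bool n

infixl 6 _⊕_

_⊕_ : ∀ {n} → Vertex n → Vertex n → Vertex n
_⊕_ = zipWith _xor_

Outmap : ℕ → Set
Outmap n = Vertex n → Vertex n

IsSink : ∀ {n} → Outmap n → Vertex n → Set
IsSink {n} o v = o v ≡ replicate n false

record IsMatoušekType {n} (o : Outmap n) : Set where
  open GF2
  field
    A               : Matrix n n
    upperTriangular : UpperTriangular A
    invertible      : Invertible A
    π               : Permutation′ n
    s               : Vertex n
    outmap          : let P = permutationMatrix π ; M = P *ᴹ A *ᴹ P ᵀ in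
                      ∀ v i → lookup (o v) i ≡ (M *ⱽ lookup (v ⊕ s)) i

-- The linear complementarity problem (M , q) asks for w , z ≥ 0 with
-- w - M z = q and wᵀ z = 0.

open Real using (Matrix; _*ⱽ_; identity; det)

-- A principal submatrix is given by the increasing enumeration of its
-- index set.
IsPMatrix : ∀ {n} → Matrix n n → Set
IsPMatrix {n} M = ∀ {k} (ι : Fin k → Fin n) →
  (∀ {a b} → a Fin.< b → ι a Fin.< ι b) →
  fromℚ 0ℚ <ʳ det (λ a b → M (ι a) (ι b))

-- Column j is that of -M (z is basic) if vⱼ = 1, and that of the
-- identity (w is basic) otherwise.
basisMatrix : ∀ {n} → Matrix n n → Vertex n → Matrix n n
basisMatrix {n} M v i j =
  if lookup v j then -ʳ M i j else identity n i j

-- x = B(v)⁻¹ q; for a P-matrix M, every B(v) is invertible, as its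
-- determinant is up to sign a principal minor of M.
IsBasicSolution : ∀ {n} → Matrix n n → (Fin n → ℝ) → Vertex n → (Fin n → ℝ) → Set
IsBasicSolution M q v x = ∀ i → (basisMatrix M v *ⱽ x) i ≈ʳ q i

IsNondegenerate : ∀ {n} → Matrix n n → (Fin n → ℝ) → Set
IsNondegenerate M q =
  ∀ v → ∃[ x ] IsBasicSolution M q v x × (∀ i → ¬ (x i ≈ʳ fromℚ 0ℚ))

IsStickneyWatsonOutmap : ∀ {n} → Matrix n n → (Fin n → ℝ) → Outmap n → Set
IsStickneyWatsonOutmap M q o =
  ∀ v → ∃[ x ] IsBasicSolution M q v x ×
    (∀ i → lookup (o v) i ≡ true ⇔ x i <ʳ fromℚ 0ℚ)

IsRealizable : ∀ {n} → Outmap n → Set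
IsRealizable {n} o = ∃[ M ] ∃[ q ]
  IsPMatrix {n} M × IsNondegenerate M q × IsStickneyWatsonOutmap M q o

IsRealizableMatoušek : ∀ {n} → Outmap n → Set
IsRealizableMatoušek o = IsMatoušekType o × IsRealizable o

data Action (n : ℕ) : Set where
  evaluate : Vertex n → Action n
  return   : Vertex n → Action n

-- All evaluated vertices with their outmap values, latest first.
Transcript : ℕ → Set
Transcript n = List (Vertex n × Vertex n)

Algorithm : ℕ → Set
Algorithm n = Transcript n → Action n

-- From transcript h, the algorithm halts after k further vertex
-- evaluations and returns w.
data Run {n} (alg : Algorithm n) (o : Outmap n) (h : Transcript n) :
         ℕ → Vertex n → Set where
  halt : ∀ {w} → alg h ≡ return w → Run alg o h 0 w
  step : ∀ {v k w} → alg h ≡ evaluate v →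
         Run alg o ((v , o v) ∷ h) k w → Run alg o h (suc k) w

-- The sink need not itself be evaluated before it is returned.
FindsSinkWith : ∀ {n} → Algorithm n → Outmap n → ℕ → Set
FindsSinkWith alg o k = ∃[ w ] Run alg o [] k w × IsSink o w

FindsRealizableMatoušekSinks : ∀ {n} → Algorithm n → Set
FindsRealizableMatoušekSinks alg =
  ∀ o → IsRealizableMatoušek o → ∃[ k ] FindsSinkWith alg o k

{-# OPTIONS --safe #-}
-- For a forest F on the coordinates, let M be its ancestor matrix; the
-- orientation v ↦ M v ⊕ 1 is induced by Murty's LCP, whose matrix has 1 on
-- the diagonal and 2 at proper ancestors, with q = -1; all entries of its
-- basic solutions are ±1.
--
-- The adversary keeps disjoint trees with a distinguished node (tail) each,
-- such that M v vanishes at every tail for all queries v so far. Hanging a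
-- tree below the tail of another one is then consistent with all answers,
-- but changes the sink, so two trees suffice to refute a premature return.
-- On a new query, two of any three tails have the same value; hanging one
-- of these trees below the tail of the other makes its own tail vanish. So
-- each query costs a factor of three in the number of trees, initially n.
module Submission where

open import Defs
open import Data.Nat using (ℕ; _≤_; _<_; _*_)
open import Data.Nat.Logarithm using (⌈log₂_⌉)
open import Data.Product using (∃-syntax; _×_)

open import Algebra.Bundles using (CommutativeRing)
open import Algebra.Bundles.Raw using (RawRing)
import Algebra.Definitions.RawMonoid as RawMonoidDefs
import Algebra.Properties.CommutativeSemigroup as CommutativeSemigroupProperties
import Algebra.Properties.Ring as RingProperties
import Algebra.Properties.Semiring.Sum as SemiringSum
open import Data.Bool.Base using (Bool; true; false; not; _xor_; _∧_; if_then_else_)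
open import Data.Bool.Properties
  using (xor-∧-commutativeRing; xor-identityʳ; xor-same; xor-assoc; xor-comm; ∧-zeroʳ; not-injective)
open import Data.Fin.Base as Fin using (Fin; zero; suc; punchIn; toℕ)
import Data.Fin.Permutation as Permutation
import Data.Fin.Properties as Finₚ
open import Data.List.Base using (List; []; _∷_; length; allFin)
open import Data.List.Properties using (length-tabulate)
open import Data.List.Relation.Unary.All as All using (All; []; _∷_)
open import Data.List.Relation.Unary.AllPairs using (AllPairs; []; _∷_)
import Data.List.Relation.Unary.AllPairs.Properties as AllPairsₚ
open import Data.Maybe.Base using (Maybe; just; nothing; maybe′)
open import Data.Nat using (zero; suc; _+_; _^_; z≤n; s≤s; z<s; s<s; _≤?_)
open import Data.Nat.Logarithm using (⌈log₂⌉-mono-≤; ⌈log₂2^n⌉≡n)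
import Data.Nat.Properties as ℕₚ
open import Data.Product using (_,_)
open import Data.Rational.Base as ℚ using (ℚ; 0ℚ; 1ℚ; ½; ∣_∣)
import Data.Rational.Properties as ℚₚ
open import Data.Vec.Base using ([]; _∷_; lookup; map; replicate)
open import Data.Vec.Properties using (lookup-map; lookup-replicate)
open import Function.Base using (_∘_; id)
open import Function.Bundles using (_⇔_; mk⇔)
open import Relation.Binary.PropositionalEquality
  using (_≡_; _≢_; refl; sym; trans; cong; cong₂; subst; module ≡-Reasoning)
open import Relation.Nullary using (contradiction; yes; no; does; ¬_)
open import Relation.Nullary.Decidable using (toWitnessFalse)

private variable
  n : ℕ

-- Forests on the coordinates, and attaching one tree below a node of another.

-- The head is the parent of node zero; parents thus have larger indices.
infixr 5 _◂_
data Forest : ℕ → Set where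
  []  : Forest 0
  _◂_ : Maybe (Fin n) → Forest n → Forest (suc n)

discrete : ∀ n → Forest n
discrete zero    = []
discrete (suc n) = nothing ◂ discrete n

-- The product of the ancestor matrix of `F` with `v`: entry i is the xor of `v` along the path from
-- i to its root.
pathXor : Forest n → Vertex n → Vertex n
pathXor []      []      = []
pathXor (m ◂ F) (b ∷ v) = (b xor maybe′ (lookup (pathXor F v)) false m) ∷ pathXor F v

root : Forest n → Fin n → Fin n
root (m ◂ F) zero    = maybe′ (suc ∘ root F) zero m
root (m ◂ F) (suc i) = suc (root F i)

-- Intended for a root r and r < t; otherwise a junk value.
attach : Forest n → Fin n → Fin n → Forest n
attach (m ◂ F) zero    (suc t) = just t ◂ F
attach (m ◂ F) (suc r) (suc t) = m ◂ attach F r t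
attach (m ◂ F) r       zero    = m ◂ F

root-≥ : (F : Forest n) (i : Fin n) → i Fin.≤ root F i
root-≥ (nothing ◂ F) zero    = z≤n
root-≥ (just p  ◂ F) zero    = z≤n
root-≥ (m       ◂ F) (suc i) = s≤s (root-≥ F i)

root-idem : (F : Forest n) (i : Fin n) → root F (root F i) ≡ root F i
root-idem (nothing ◂ F) zero    = refl
root-idem (just p  ◂ F) zero    = cong suc (root-idem F p)
root-idem (m       ◂ F) (suc i) = cong suc (root-idem F i)

root-discrete : (i : Fin n) → root (discrete n) i ≡ i
root-discrete zero    = refl
root-discrete (suc i) = cong suc (root-discrete i)


-- Only the root `r` gets a new parent, so a path that ends at another root does not change.
root-attach-other : (F : Forest n) {r t k : Fin n} → root F r ≡ r → root F k ≢ r →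
                    root (attach F r t) k ≡ root F k
root-attach-other (m       ◂ F) {r = zero}  {zero}          _ _ = refl
root-attach-other (m       ◂ F) {r = suc r} {zero}          _ _ = refl
root-attach-other (nothing ◂ F) {zero}  {suc t} {zero}  _ k≢r = contradiction refl k≢r
root-attach-other (m       ◂ F) {zero}  {suc t} {suc k} _ _ = refl
root-attach-other (nothing ◂ F) {suc r} {suc t} {zero}  _ _ = refl
root-attach-other (just p  ◂ F) {suc r} {suc t} {zero}  r≡ k≢r =
  cong suc (root-attach-other F (Finₚ.suc-injective r≡) (k≢r ∘ cong suc))
root-attach-other (m       ◂ F) {suc r} {suc t} {suc k} r≡ k≢r =
  cong suc (root-attach-other F (Finₚ.suc-injective r≡) (k≢r ∘ cong suc))

root-attach-tree : (F : Forest n) {r t k : Fin n} → r Fin.< t → root F r ≡ r → root F k ≡ r →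
                   root (attach F r t) k ≡ root F t
root-attach-tree (nothing ◂ F) {zero}  {suc t} {zero}  _ _ _ = refl
root-attach-tree (just p  ◂ F) {suc r} {suc t} {zero}  (s<s r<t) r≡ k≡ =
  cong suc (root-attach-tree F r<t (Finₚ.suc-injective r≡) (Finₚ.suc-injective k≡))
root-attach-tree (m       ◂ F) {suc r} {suc t} {suc k} (s<s r<t) r≡ k≡ =
  cong suc (root-attach-tree F r<t (Finₚ.suc-injective r≡) (Finₚ.suc-injective k≡))

pathXor-attach-other : (F : Forest n) {r t k : Fin n} (v : Vertex n) →
  root F r ≡ r → root F k ≢ r → lookup (pathXor (attach F r t) v) k ≡ lookup (pathXor F v) k
pathXor-attach-other (m       ◂ F) {zero}  {zero}          v _ _ = refl
pathXor-attach-other (m       ◂ F) {suc r} {zero}          v _ _ = refl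
pathXor-attach-other (nothing ◂ F) {zero}  {suc t} {zero}  v _ k≢r = contradiction refl k≢r
pathXor-attach-other (m       ◂ F) {zero}  {suc t} {suc k} (b ∷ v) _ _ = refl
pathXor-attach-other (nothing ◂ F) {suc r} {suc t} {zero}  (b ∷ v) _ _ = refl
pathXor-attach-other (just p  ◂ F) {suc r} {suc t} {zero}  (b ∷ v) r≡ k≢r =
  cong (b xor_) (pathXor-attach-other F v (Finₚ.suc-injective r≡) (k≢r ∘ cong suc))
pathXor-attach-other (m       ◂ F) {suc r} {suc t} {suc k} (b ∷ v) r≡ k≢r =
  pathXor-attach-other F v (Finₚ.suc-injective r≡) (k≢r ∘ cong suc)

-- The path of `k` used to end at `r` and now continues from `t`. A root has the largest index of
-- its tree, so `r < t` keeps `t` outside the tree of `r`, and the path of `t` is unchanged.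
pathXor-attach-tree : (F : Forest n) {r t k : Fin n} (v : Vertex n) →
  r Fin.< t → root F r ≡ r → root F k ≡ r →
  lookup (pathXor (attach F r t) v) k ≡ lookup (pathXor F v) k xor lookup (pathXor F v) t
pathXor-attach-tree (nothing ◂ F) {zero}  {suc t} {zero}  (b ∷ v) _ _ _ =
  cong (_xor lookup (pathXor F v) t) (sym (xor-identityʳ b))
pathXor-attach-tree (just p  ◂ F) {suc r} {suc t} {zero}  (b ∷ v) (s<s r<t) r≡ k≡ =
  trans (cong (b xor_) (pathXor-attach-tree F v r<t (Finₚ.suc-injective r≡) (Finₚ.suc-injective k≡)))
        (sym (xor-assoc b _ _))
pathXor-attach-tree (m       ◂ F) {suc r} {suc t} {suc k} (b ∷ v) (s<s r<t) r≡ k≡ =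
  pathXor-attach-tree F v r<t (Finₚ.suc-injective r≡) (Finₚ.suc-injective k≡)

Vanishes : Forest n → Vertex n → Fin n → Set
Vanishes F v t = lookup (pathXor F v) t ≡ false

-- Either nothing is attached, or the paths through `r` gain the xor along the path of `t`, which is
-- zero. Hence old answers survive attachments.
pathXor-attach-vanishing : (F : Forest n) {r t : Fin n} (v : Vertex n) →
  root F r ≡ r → Vanishes F v t → pathXor (attach F r t) v ≡ pathXor F v
pathXor-attach-vanishing (m       ◂ F) {zero}  {zero}  v _ _ = refl
pathXor-attach-vanishing (m       ◂ F) {suc r} {zero}  v _ _ = refl
pathXor-attach-vanishing (nothing ◂ F) {zero}  {suc t} (b ∷ v) _ t≡0 =
  cong (λ c → (b xor c) ∷ pathXor F v) t≡0
pathXor-attach-vanishing (m       ◂ F) {suc r} {suc t} (b ∷ v) r≡ t≡0 =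
  cong (λ w → (b xor maybe′ (lookup w) false m) ∷ w)
       (pathXor-attach-vanishing F v (Finₚ.suc-injective r≡) t≡0)

-- Separated tails and their refinement under a query.

Below : Forest n → Fin n → Fin n → Set
Below F t t′ = root F t Fin.< t′

-- As a root is the largest index of its tree, the tails of such a list lie in distinct trees, and
-- each tree can be attached below any later tail.
Separated : Forest n → List (Fin n) → Set
Separated F = AllPairs (Below F)

-- `subset` expresses inclusion through the predicates that it transfers. The two `away` fields
-- serve the recursion: trees whose indices precede all of `ts` are untouched, so tails set aside
-- earlier can still be merged afterwards.
record Refinement (F : Forest n) (v : Vertex n) (ts : List (Fin n)) (p : ℕ) : Set₁ where
  field
    F′        : Forest n
    ts′       : List (Fin n)
    subset    : ∀ {P : Fin n → Set} → All P ts → All P ts′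
    size      : p ≤ length ts′
    separated : Separated F′ ts′
    vanishing : All (Vanishes F′ v) ts′
    agree     : ∀ u → All (Vanishes F u) ts → pathXor F′ u ≡ pathXor F u
    root-away : ∀ {k} → All (Below F k) ts → root F′ k ≡ root F k
    path-away : ∀ {k} u → All (Below F k) ts → lookup (pathXor F′ u) k ≡ lookup (pathXor F u) k

AllPairs-map-All : ∀ {A : Set} {Q : A → Set} {R S : A → A → Set} →
  (∀ {x y} → Q x → R x y → S x y) → ∀ {xs} → All Q xs → AllPairs R xs → AllPairs S xs
AllPairs-map-All f []       []         = []
AllPairs-map-All f (q ∷ qs) (rs ∷ rss) = All.map (f q) rs ∷ AllPairs-map-All f qs rss

module _ {F : Forest n} {v : Vertex n} {x y : Fin n} {rest : List (Fin n)} {p : ℕ}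
         (x<y : Below F x y) (x<rest : All (Below F x) rest) (y<rest : All (Below F y) rest)
         (equal : lookup (pathXor F v) x ≡ lookup (pathXor F v) y)
         (R : Refinement F v rest p) where

  private
    module R = Refinement R
    G = R.F′
    r = root G x

    rx : r ≡ root F x
    rx = R.root-away x<rest

    ry : root G y ≡ root F y
    ry = R.root-away y<rest

    r<y : r Fin.< y
    r<y = subst (Fin._< y) (sym rx) x<y

    r-root : root G r ≡ r
    r-root = root-idem G x

    other : ∀ {k} → r Fin.< k → root G k ≢ r
    other {k} r<k eq = ℕₚ.<⇒≢ (ℕₚ.<-≤-trans r<k (root-≥ G k)) (cong Fin.toℕ (sym eq))

    G′ = attach G r y

    root-x : root G′ x ≡ root F y
    root-x = trans (root-attach-tree G r<y r-root refl) ry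

    r<rest : All (r Fin.<_) R.ts′
    r<rest = R.subset (All.map (subst (Fin._< _) (sym rx)) x<rest)

    away : ∀ {k} → Below F k x → root F k ≡ root G k → root G k ≢ r
    away k<x eq k≡r = ℕₚ.<⇒≢ (ℕₚ.<-≤-trans k<x (root-≥ G x)) (cong Fin.toℕ (trans eq k≡r))

  -- Once the later tails are refined, the tree of `x` is hung below `y`. The value at `x` becomes
  -- the xor of two equal bits, hence zero, and `x` is kept as the tail of the joint tree.
  merge : Refinement F v (x ∷ y ∷ rest) (suc p)
  merge = record
    { F′  = G′
    ; ts′ = x ∷ R.ts′
    ; subset = λ { (px ∷ _ ∷ ps) → px ∷ R.subset ps }
    ; size = s≤s R.size
    -- The joint tree has the root of `y`, so its separation from the later tails is inherited from
    -- `y`.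
    ; separated = All.map (subst (Fin._< _) (sym root-x)) (R.subset y<rest) ∷
        AllPairs-map-All (λ r<k k<l → subst (Fin._< _) (sym (root-attach-other G r-root (other r<k))) k<l)
          r<rest R.separated
    ; vanishing =
        (begin
          lookup (pathXor G′ v) x
            ≡⟨ pathXor-attach-tree G v r<y r-root refl ⟩
          lookup (pathXor G v) x xor lookup (pathXor G v) y
            ≡⟨ cong₂ _xor_ (trans (R.path-away v x<rest) equal) (R.path-away v y<rest) ⟩
          lookup (pathXor F v) y xor lookup (pathXor F v) y
            ≡⟨ xor-same (lookup (pathXor F v) y) ⟩
          false ∎)
        ∷ All.zipWith (λ (r<k , k≡0) → trans (pathXor-attach-other G v r-root (other r<k)) k≡0)
            (r<rest , R.vanishing)
    ; agree = λ { u (_ ∷ y≡0 ∷ rest≡0) →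
        trans (pathXor-attach-vanishing G u r-root (trans (R.path-away u y<rest) y≡0))
              (R.agree u rest≡0) }
    ; root-away = λ { (k<x ∷ _ ∷ k<rest) →
        trans (root-attach-other G r-root (away k<x (sym (R.root-away k<rest)))) (R.root-away k<rest) }
    ; path-away = λ { u (k<x ∷ _ ∷ k<rest) →
        trans (pathXor-attach-other G u r-root (away k<x (sym (R.root-away k<rest)))) (R.path-away u k<rest) }
    }
    where open ≡-Reasoning

-- Used to discard a tail: `ts` occurs in the fields only in hypotheses on all its members, and the
-- longer list implies these.
weaken : ∀ {F : Forest n} {v ts ts₁ p} → (∀ {P : Fin n → Set} → All P ts₁ → All P ts) →
         Refinement F v ts p → Refinement F v ts₁ p
weaken sub R = record
  { F′ = F′ ; ts′ = ts′ ; subset = subset ∘ sub ; size = size ; separated = separated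
  ; vanishing = vanishing ; agree = λ u → agree u ∘ sub
  ; root-away = root-away ∘ sub ; path-away = λ u → path-away u ∘ sub }
  where open Refinement R

-- Tails are used in consecutive triples. Two of three bits agree, so each triple gives one merged
-- tree and one new tail; the remaining tail is dropped, as are all tails beyond `3 * p`.
refine : ∀ (F : Forest n) v {ts} p → 3 * p ≤ length ts → Separated F ts → Refinement F v ts p
refine F v zero _ _ = record
  { F′ = F ; ts′ = [] ; subset = λ _ → [] ; size = z≤n ; separated = [] ; vanishing = []
  ; agree = λ _ _ → refl ; root-away = λ _ → refl ; path-away = λ _ _ → refl }
refine F v (suc p) 3p≤ sep = triple (ℕₚ.≤-trans (ℕₚ.≤-reflexive (sym (ℕₚ.*-suc 3 p))) 3p≤) sep
  where
  triple : ∀ {ts} → 3 + 3 * p ≤ length ts → Separated F ts → Refinement F v ts (suc p)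
  triple {a ∷ b ∷ c ∷ rest} (s≤s (s≤s (s≤s 3p≤))) ((ab ∷ ac ∷ ar) ∷ (bc ∷ br) ∷ cr ∷ sep)
    with refine F v p 3p≤ sep
       | lookup (pathXor F v) a in a≡ | lookup (pathXor F v) b in b≡ | lookup (pathXor F v) c in c≡
  ... | R | true  | true  | _     = weaken (λ { (x ∷ y ∷ _ ∷ zs) → x ∷ y ∷ zs }) (merge ab ar br (trans a≡ (sym b≡)) R)
  ... | R | false | false | _     = weaken (λ { (x ∷ y ∷ _ ∷ zs) → x ∷ y ∷ zs }) (merge ab ar br (trans a≡ (sym b≡)) R)
  ... | R | true  | false | true  = weaken (λ { (x ∷ _ ∷ y ∷ zs) → x ∷ y ∷ zs }) (merge ac ar cr (trans a≡ (sym c≡)) R)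
  ... | R | false | true  | false = weaken (λ { (x ∷ _ ∷ y ∷ zs) → x ∷ y ∷ zs }) (merge ac ar cr (trans a≡ (sym c≡)) R)
  ... | R | true  | false | false = weaken (λ { (_ ∷ x ∷ y ∷ zs) → x ∷ y ∷ zs }) (merge bc br cr (trans b≡ (sym c≡)) R)
  ... | R | false | true  | true  = weaken (λ { (_ ∷ x ∷ y ∷ zs) → x ∷ y ∷ zs }) (merge bc br cr (trans b≡ (sym c≡)) R)

-- Sums, identity matrices and triangular determinants over a commutative ring.

module Sums {c ℓ} (R : CommutativeRing c ℓ) where
  open CommutativeRing R hiding (zero; _+_) renaming (_*_ to _·_; refl to ≈-refl; trans to ≈-trans)
  open SemiringSum semiring public using (sum; sum-cong-≋; sum-cong-≗; sum-replicate-zero)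
  open Matrices rawRing public

  sum-zero : {f : Fin n → Carrier} → (∀ k → f k ≈ 0#) → sum f ≈ 0#
  sum-zero {n = n} f≈0 = ≈-trans (sum-cong-≋ f≈0) (sum-replicate-zero n)

  sum-identity : (i : Fin n) (f : Fin n → Carrier) → sum (λ k → identity n i k · f k) ≈ f i
  sum-identity zero    f =
    ≈-trans (+-cong (*-identityˡ (f zero)) (sum-zero λ k → zeroˡ (f (suc k)))) (+-identityʳ (f zero))
  sum-identity (suc i) f =
    ≈-trans (+-cong (zeroˡ (f zero)) (sum-identity i (f ∘ suc))) (+-identityˡ (f (suc i)))

  identity-*ᴹ : ∀ {m} (A : Matrix n m) → identity n *ᴹ A ≈ᴹ A
  identity-*ᴹ A i j = sum-identity i (λ k → A k j)

  *ᴹ-identityᵀ : ∀ {m} (A : Matrix m n) → A *ᴹ identity n ᵀ ≈ᴹ A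
  *ᴹ-identityᵀ A i j = ≈-trans (sum-cong-≋ λ k → *-comm (A i k) _) (sum-identity j (A i))

  det-zeroColumn : (A : Matrix (suc n) (suc n)) → (∀ i → A i zero ≈ 0#) → det A ≈ 0#
  -- In the first-row expansion, every minor with j > 0 contains the part of the first column below
  -- the diagonal, which is zero; only the term of j = 0 survives.
  det-unitriangular : (A : Matrix n n) → UpperTriangular A → (∀ i → A i i ≈ 1#) → det A ≈ 1#

  signed-zero : ∀ k {x} → x ≈ 0# → signed k x ≈ 0#
  signed-zero zero    x≈0 = x≈0
  signed-zero (suc k) x≈0 = ≈-trans (-‿cong (signed-zero k x≈0)) -0#≈0#
    where open RingProperties ring using (-0#≈0#)

  det-zeroColumn A A≈0 = sum-zero (vanish A A≈0)
    where
    vanish : ∀ {n} (A : Matrix (suc n) (suc n)) → (∀ i → A i zero ≈ 0#) →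
             ∀ j → signed (toℕ j) (A zero j · det (λ i k → A (suc i) (punchIn j k))) ≈ 0#
    vanish A A≈0 zero = ≈-trans (*-congʳ (A≈0 zero)) (zeroˡ _)
    vanish {suc n} A A≈0 (suc j) = signed-zero (suc (toℕ j))
      (≈-trans (*-congˡ (det-zeroColumn (λ i k → A (suc i) (punchIn (suc j) k)) (A≈0 ∘ suc))) (zeroʳ _))

  det-unitriangular {zero}  A upper unit = ≈-refl
  det-unitriangular {suc n} A upper unit =
    ≈-trans (+-cong
      (≈-trans (*-cong (unit zero)
                 (det-unitriangular (λ i k → A (suc i) (suc k))
                   (λ i j j<i → upper (suc i) (suc j) (s<s j<i)) (unit ∘ suc)))
               (*-identityˡ 1#))
      (sum-zero (vanish A upper)))
      (+-identityʳ 1#)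
    where
    vanish : ∀ {n} (A : Matrix (suc n) (suc n)) → UpperTriangular A →
      ∀ j → signed (suc (toℕ j)) (A zero (suc j) · det (λ i k → A (suc i) (punchIn (suc j) k))) ≈ 0#
    vanish {suc n} A upper j = signed-zero (suc (toℕ j))
      (≈-trans (*-congˡ (det-zeroColumn (λ i k → A (suc i) (punchIn (suc j) k))
                          (λ i → upper (suc i) zero z<s)))
               (zeroʳ _))

module 𝔹Σ = Sums xor-∧-commutativeRing
module ℚΣ = Sums ℚₚ.+-*-commutativeRing

-- Ancestor matrices over GF(2) and the Matoušek-type property.

ancestors : Forest n → GF2.Matrix n n
ancestors (m ◂ F) zero    zero    = true
ancestors (m ◂ F) zero    (suc j) = maybe′ (λ p → ancestors F p j) false m
ancestors (m ◂ F) (suc i) zero    = false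
ancestors (m ◂ F) (suc i) (suc j) = ancestors F i j

isParent : Maybe (Fin n) → Fin n → Bool
isParent m j = maybe′ (λ p → GF2.identity _ p j) false m

-- The ancestor matrix is the sum of all powers of the parent matrix N, that is the inverse of 1 -
-- N, and 1 - N = 1 + N over GF(2).
ancestors⁻¹ : Forest n → GF2.Matrix n n
ancestors⁻¹ (m ◂ F) zero    zero    = true
ancestors⁻¹ (m ◂ F) zero    (suc j) = isParent m j
ancestors⁻¹ (m ◂ F) (suc i) zero    = false
ancestors⁻¹ (m ◂ F) (suc i) (suc j) = ancestors⁻¹ F i j

ancestors-upperTriangular : (F : Forest n) → GF2.UpperTriangular (ancestors F)
ancestors-upperTriangular (m ◂ F) (suc i) zero    _         = refl
ancestors-upperTriangular (m ◂ F) (suc i) (suc j) (s<s j<i) = ancestors-upperTriangular F i j j<i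

ancestors-inverseʳ : (F : Forest n) → ancestors F GF2.*ᴹ ancestors⁻¹ F GF2.≈ᴹ GF2.identity n
ancestors-inverseʳ (m ◂ F) zero zero =
  cong not (𝔹Σ.sum-zero λ k → ∧-zeroʳ (maybe′ (λ p → ancestors F p k) false m))
ancestors-inverseʳ (_◂_ {n} nothing F) zero (suc j) = 𝔹Σ.sum-zero {n} λ k → refl
ancestors-inverseʳ (just p ◂ F) zero (suc j) =
  trans (cong (GF2.identity _ p j xor_) (ancestors-inverseʳ F p j)) (xor-same (GF2.identity _ p j))
ancestors-inverseʳ (m ◂ F) (suc i) zero = 𝔹Σ.sum-zero λ k → ∧-zeroʳ (ancestors F i k)
ancestors-inverseʳ (m ◂ F) (suc i) (suc j) = ancestors-inverseʳ F i j

ancestors-inverseˡ : (F : Forest n) → ancestors⁻¹ F GF2.*ᴹ ancestors F GF2.≈ᴹ GF2.identity n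
ancestors-inverseˡ (m ◂ F) zero zero = cong not (𝔹Σ.sum-zero λ k → ∧-zeroʳ (isParent m k))
ancestors-inverseˡ (_◂_ {n} nothing F) zero (suc j) = 𝔹Σ.sum-zero {n} λ k → refl
ancestors-inverseˡ (just p ◂ F) zero (suc j) =
  trans (cong (ancestors F p j xor_) (𝔹Σ.identity-*ᴹ (ancestors F) p j)) (xor-same (ancestors F p j))
ancestors-inverseˡ (m ◂ F) (suc i) zero = 𝔹Σ.sum-zero λ k → ∧-zeroʳ (ancestors⁻¹ F i k)
ancestors-inverseˡ (m ◂ F) (suc i) (suc j) = ancestors-inverseˡ F i j

-- The sink of `orientation F`: each path to a root contains exactly one root, so every path xor is
-- 1.
roots : Forest n → Vertex n
roots []            = []
roots (nothing ◂ F) = true  ∷ roots F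
roots (just p ◂ F)  = false ∷ roots F

pathXor-roots : (F : Forest n) (i : Fin n) → lookup (pathXor F (roots F)) i ≡ true
pathXor-roots (nothing ◂ F) zero    = refl
pathXor-roots (just p ◂ F)  zero    = pathXor-roots F p
pathXor-roots (nothing ◂ F) (suc i) = pathXor-roots F i
pathXor-roots (just p ◂ F)  (suc i) = pathXor-roots F i

xor-interchange : ∀ a b c d → (a xor b) xor (c xor d) ≡ (a xor c) xor (b xor d)
xor-interchange = interchange
  where open CommutativeSemigroupProperties
               (CommutativeRing.+-commutativeSemigroup xor-∧-commutativeRing) using (interchange)

pathXor-⊕ : (F : Forest n) (u v : Vertex n) (i : Fin n) →
            lookup (pathXor F (u ⊕ v)) i ≡ lookup (pathXor F u) i xor lookup (pathXor F v) i
pathXor-⊕ (nothing ◂ F) (a ∷ u) (b ∷ v) zero = xor-interchange a b false false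
pathXor-⊕ (just p ◂ F)  (a ∷ u) (b ∷ v) zero =
  trans (cong ((a xor b) xor_) (pathXor-⊕ F u v p)) (xor-interchange a b _ _)
pathXor-⊕ (m ◂ F)       (a ∷ u) (b ∷ v) (suc i) = pathXor-⊕ F u v i

ancestors-*ⱽ : (F : Forest n) (v : Vertex n) (i : Fin n) →
               (ancestors F GF2.*ⱽ lookup v) i ≡ lookup (pathXor F v) i
ancestors-*ⱽ (_◂_ {n} nothing F) (b ∷ v) zero = cong (b xor_) (𝔹Σ.sum-zero {n} λ k → refl)
ancestors-*ⱽ (just p ◂ F)  (b ∷ v) zero = cong (b xor_) (ancestors-*ⱽ F v p)
ancestors-*ⱽ (m ◂ F) (b ∷ v) (suc i) = ancestors-*ⱽ F v i

-- The all-ones offset is the same for every forest, so answers agree whenever the path xors do,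
-- while the sink depends on the forest.
orientation : Forest n → Outmap n
orientation F v = map not (pathXor F v)

-- For s = `roots F`, M s = 1, so M v ⊕ 1 = M (v ⊕ s) by linearity. As parents have larger indices,
-- M is already upper triangular and the permutation is the identity.
orientation-isMatoušek : (F : Forest n) → IsMatoušekType (orientation F)
orientation-isMatoušek F = record
  { A               = ancestors F
  ; upperTriangular = ancestors-upperTriangular F
  ; invertible      = ancestors⁻¹ F , ancestors-inverseʳ F , ancestors-inverseˡ F
  ; π               = Permutation.id
  ; s               = roots F
  ; outmap          = λ v i → begin
      lookup (map not (pathXor F v)) i
        ≡⟨ lookup-map i not (pathXor F v) ⟩
      true xor lookup (pathXor F v) i
        ≡⟨ xor-comm true (lookup (pathXor F v) i) ⟩
      lookup (pathXor F v) i xor true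
        ≡⟨ cong (lookup (pathXor F v) i xor_) (pathXor-roots F i) ⟨
      lookup (pathXor F v) i xor lookup (pathXor F (roots F)) i
        ≡⟨ pathXor-⊕ F v (roots F) i ⟨
      lookup (pathXor F (v ⊕ roots F)) i
        ≡⟨ ancestors-*ⱽ F (v ⊕ roots F) i ⟨
      (ancestors F GF2.*ⱽ lookup (v ⊕ roots F)) i
        ≡⟨ 𝔹Σ.sum-cong-≗ (λ k → cong (_∧ lookup (v ⊕ roots F) k) (conjugate i k)) ⟨
      ((GF2.identity _ GF2.*ᴹ ancestors F GF2.*ᴹ GF2.identity _ GF2.ᵀ) GF2.*ⱽ lookup (v ⊕ roots F)) i ∎
  }
  where
  open ≡-Reasoning
  conjugate : GF2.identity _ GF2.*ᴹ ancestors F GF2.*ᴹ GF2.identity _ GF2.ᵀ GF2.≈ᴹ ancestors F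
  conjugate i k = trans (𝔹Σ.*ᴹ-identityᵀ (GF2.identity _ GF2.*ᴹ ancestors F) i k) (𝔹Σ.identity-*ᴹ (ancestors F) i k)

-- Realizability through Murty's complementarity problem.

≡⇒≈ʳ : ∀ x y → (∀ k → seq x k ≡ seq y k) → x ≈ʳ y
≡⇒≈ʳ x y eq ε ε>0 = 0 , λ k _ → begin
  ∣ seq x k ℚ.- seq y k ∣ ≡⟨ cong (λ z → ∣ z ℚ.- seq y k ∣) (eq k) ⟩
  ∣ seq y k ℚ.- seq y k ∣ ≡⟨ cong ∣_∣ (ℚₚ.+-inverseʳ (seq y k)) ⟩
  0ℚ                      ≤⟨ ℚₚ.<⇒≤ ε>0 ⟩
  ε                       ∎
  where open ℚₚ.≤-Reasoning

module ℝΣ = RawMonoidDefs (RawRing.+-rawMonoid ℝ-rawRing)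

-- Real arithmetic acts termwise on the representing sequences, which reduces sums and determinants
-- to rational ones.
seq-sum : ∀ k (f : Fin n → ℝ) → seq (ℝΣ.sum f) k ≡ ℚΣ.sum (λ i → seq (f i) k)
seq-sum {n = zero}  k f = refl
seq-sum {n = suc n} k f = cong (seq (f zero) k ℚ.+_) (seq-sum k (f ∘ suc))

seq-signed : ∀ k j x → seq (Real.signed j x) k ≡ ℚΣ.signed j (seq x k)
seq-signed k zero    x = refl
seq-signed k (suc j) x = cong ℚ.-_ (seq-signed k j x)

seq-det : ∀ k (A : Real.Matrix n n) → seq (Real.det A) k ≡ ℚΣ.det (λ i j → seq (A i j) k)
seq-det {n = zero}  k A = refl
seq-det {n = suc n} k A = trans (seq-sum k (λ j → Real.signed (toℕ j) (term j)))
  (ℚΣ.sum-cong-≗ λ j → trans (seq-signed k (toℕ j) (term j))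
    (cong (λ d → ℚΣ.signed (toℕ j) (seq (A zero j) k ℚ.* d))
      (seq-det k (λ i l → A (suc i) (punchIn j l)))))
  where
  term : Fin (suc n) → ℝ
  term j = A zero j *ʳ Real.det (λ i l → A (suc i) (punchIn j l))

2ℚ : ℚ
2ℚ = 1ℚ ℚ.+ 1ℚ

doubled : Bool → ℚ
doubled b = if b then 2ℚ else 0ℚ

murty : Forest n → ℚΣ.Matrix n n
murty (m ◂ F) zero    zero    = 1ℚ
murty (m ◂ F) zero    (suc j) = doubled (maybe′ (λ p → ancestors F p j) false m)
murty (m ◂ F) (suc i) zero    = 0ℚ
murty (m ◂ F) (suc i) (suc j) = murty F i j

murty-upperTriangular : (F : Forest n) → ℚΣ.UpperTriangular (murty F)
murty-upperTriangular (m ◂ F) (suc i) zero    _         = refl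
murty-upperTriangular (m ◂ F) (suc i) (suc j) (s<s j<i) = murty-upperTriangular F i j j<i

murty-diagonal : (F : Forest n) (i : Fin n) → murty F i i ≡ 1ℚ
murty-diagonal (m ◂ F) zero    = refl
murty-diagonal (m ◂ F) (suc i) = murty-diagonal F i

murtyʳ : Forest n → Real.Matrix n n
murtyʳ F i j = fromℚ (murty F i j)

-- A principal submatrix, enumerated increasingly, is again upper unitriangular, so every principal
-- minor is 1.
murty-isPMatrix : (F : Forest n) → IsPMatrix (murtyʳ F)
murty-isPMatrix F ι ι-mono = 1ℚ , ℚₚ.positive⁻¹ 1ℚ , 0 , λ k _ → ℚₚ.≤-reflexive (sym
  (trans (seq-det k (λ a b → murtyʳ F (ι a) (ι b)))
    (ℚΣ.det-unitriangular (λ a b → murty F (ι a) (ι b))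
      (λ a b b<a → murty-upperTriangular F (ι a) (ι b) (ι-mono b<a))
      (λ a → murty-diagonal F (ι a)))))

sgn : Bool → ℚ
sgn b = if b then ℚ.- 1ℚ else 1ℚ

-- The entry is -1 exactly where `orientation F v` is 1, so its sign encodes the outmap bit.
solution : Forest n → Vertex n → Fin n → ℚ
solution F v i = sgn (not (lookup (pathXor F v) i))

basis : ℚΣ.Matrix n n → Vertex n → ℚΣ.Matrix n n
basis {n} M v i j = if lookup v j then ℚ.- M i j else ℚΣ.identity n i j

if-zero : ∀ b x → (if b then 0ℚ else 0ℚ) ℚ.* x ≡ 0ℚ
if-zero true  = ℚₚ.*-zeroˡ
if-zero false = ℚₚ.*-zeroˡ

-- Summand k is x_{par k} − x_k, so the sum telescopes along the path to the root.
ancestors-sum : (F : Forest n) (v : Vertex n) (p : Fin n) →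
  ℚΣ.sum (λ k → (if lookup v k then ℚ.- doubled (ancestors F p k) else 0ℚ) ℚ.* solution F v k)
    ≡ ℚ.- 1ℚ ℚ.- solution F v p
-- At a root the missing parent has the default xor `false`, that is the value -1, which is the
-- constant left by the telescoping.
ancestors-sum (nothing ◂ F) (b ∷ v) zero =
  trans (cong ((if b then ℚ.- 2ℚ else 0ℚ) ℚ.* sgn (not (b xor false)) ℚ.+_)
          (ℚΣ.sum-zero λ k → if-zero (lookup v k) (solution F v k)))
        (base b)
  where
  base : ∀ b → (if b then ℚ.- 2ℚ else 0ℚ) ℚ.* sgn (not (b xor false)) ℚ.+ 0ℚ
               ≡ ℚ.- 1ℚ ℚ.- sgn (not (b xor false))
  base true  = refl
  base false = refl
ancestors-sum (just p ◂ F) (b ∷ v) zero =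
  trans (cong ((if b then ℚ.- 2ℚ else 0ℚ) ℚ.* sgn (not (b xor lookup (pathXor F v) p)) ℚ.+_)
          (ancestors-sum F v p))
        (telescope b (lookup (pathXor F v) p))
  where
  telescope : ∀ b c → (if b then ℚ.- 2ℚ else 0ℚ) ℚ.* sgn (not (b xor c)) ℚ.+ (ℚ.- 1ℚ ℚ.- sgn (not c))
                      ≡ ℚ.- 1ℚ ℚ.- sgn (not (b xor c))
  telescope true  true  = refl
  telescope true  false = refl
  telescope false true  = refl
  telescope false false = refl
ancestors-sum (m ◂ F) (b ∷ v) (suc p) =
  trans (cong₂ ℚ._+_ (if-zero b (solution (m ◂ F) (b ∷ v) zero)) (ancestors-sum F v p))
        (ℚₚ.+-identityˡ _)

-- The diagonal summand is -x_i or x_i according to `v`, in both cases x_{par i}; the proper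
-- ancestors telescope to -1 - x_{par i}.
murty-solution : (F : Forest n) (v : Vertex n) (i : Fin n) →
                 (basis (murty F) v ℚΣ.*ⱽ solution F v) i ≡ ℚ.- 1ℚ
murty-solution (nothing ◂ F) (b ∷ v) zero =
  trans (cong ((if b then ℚ.- 1ℚ else 1ℚ) ℚ.* sgn (not (b xor false)) ℚ.+_)
          (ℚΣ.sum-zero λ k → if-zero (lookup v k) (solution F v k)))
        (base b)
  where
  base : ∀ b → (if b then ℚ.- 1ℚ else 1ℚ) ℚ.* sgn (not (b xor false)) ℚ.+ 0ℚ ≡ ℚ.- 1ℚ
  base true  = refl
  base false = refl
murty-solution (just p ◂ F) (b ∷ v) zero =
  trans (cong ((if b then ℚ.- 1ℚ else 1ℚ) ℚ.* sgn (not (b xor lookup (pathXor F v) p)) ℚ.+_)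
          (ancestors-sum F v p))
        (cancel b (lookup (pathXor F v) p))
  where
  cancel : ∀ b c → (if b then ℚ.- 1ℚ else 1ℚ) ℚ.* sgn (not (b xor c)) ℚ.+ (ℚ.- 1ℚ ℚ.- sgn (not c))
                   ≡ ℚ.- 1ℚ
  cancel true  true  = refl
  cancel true  false = refl
  cancel false true  = refl
  cancel false false = refl
murty-solution (m ◂ F) (b ∷ v) (suc i) =
  trans (cong₂ ℚ._+_ (if-zero b (solution (m ◂ F) (b ∷ v) zero)) (murty-solution F v i))
        (ℚₚ.+-identityˡ _)

solutionʳ : Forest n → Vertex n → Fin n → ℝ
solutionʳ F v i = fromℚ (solution F v i)

rhs : Fin n → ℝ
rhs _ = fromℚ (ℚ.- 1ℚ)

seq-basis : ∀ k (M : ℚΣ.Matrix n n) v i j →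
            seq (basisMatrix (λ i j → fromℚ (M i j)) v i j) k ≡ basis M v i j
seq-basis k M v i j with lookup v j | does (i Finₚ.≟ j)
... | true  | _     = refl
... | false | true  = refl
... | false | false = refl

solution-isBasic : (F : Forest n) (v : Vertex n) → IsBasicSolution (murtyʳ F) rhs v (solutionʳ F v)
solution-isBasic F v i = ≡⇒≈ʳ ((basisMatrix (murtyʳ F) v Real.*ⱽ solutionʳ F v) i) (rhs i) λ k →
  trans (seq-sum k (λ j → basisMatrix (murtyʳ F) v i j *ʳ solutionʳ F v j))
    (trans (ℚΣ.sum-cong-≗ λ j → cong (ℚ._* solution F v j) (seq-basis k (murty F) v i j))
      (murty-solution F v i))

sgn≉0 : ∀ b → ¬ (fromℚ (sgn b) ≈ʳ fromℚ 0ℚ)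
sgn≉0 b sgn≈0 with sgn≈0 ½ (ℚₚ.positive⁻¹ ½)
... | N , close = 1≰½ b (close N ℕₚ.≤-refl)
  where
  1≰½ : ∀ b → ¬ (∣ sgn b ℚ.- 0ℚ ∣ ℚ.≤ ½)
  1≰½ true  = toWitnessFalse {a? = ∣ sgn true ℚ.- 0ℚ ∣ ℚₚ.≤? ½} _
  1≰½ false = toWitnessFalse {a? = ∣ sgn false ℚ.- 0ℚ ∣ ℚₚ.≤? ½} _

sgn<0 : ∀ b → b ≡ true ⇔ fromℚ (sgn b) <ʳ fromℚ 0ℚ
sgn<0 true  = mk⇔ (λ _ → 1ℚ , ℚₚ.positive⁻¹ 1ℚ , 0 , λ _ _ → ℚₚ.≤-refl) (λ _ → refl)
sgn<0 false = mk⇔ (λ ()) λ (ε , ε>0 , N , below) →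
  contradiction
    (ℚₚ.<-≤-trans (ℚₚ.+-mono-< (ℚₚ.positive⁻¹ 1ℚ) ε>0) (below N ℕₚ.≤-refl))
    (ℚₚ.<-irrefl refl)

orientation-isRealizable : (F : Forest n) → IsRealizable (orientation F)
orientation-isRealizable F = murtyʳ F , rhs , murty-isPMatrix F
  , (λ v → solutionʳ F v , solution-isBasic F v , λ i → sgn≉0 (not (lookup (pathXor F v) i)))
  , (λ v → solutionʳ F v , solution-isBasic F v , λ i →
      subst (λ b → b ≡ true ⇔ solutionʳ F v i <ʳ fromℚ 0ℚ)
        (sym (lookup-map i not (pathXor F v))) (sgn<0 (not (lookup (pathXor F v) i))))

orientation-isRealizableMatoušek : (F : Forest n) → IsRealizableMatoušek (orientation F)
orientation-isRealizableMatoušek F = orientation-isMatoušek F , orientation-isRealizable F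

-- Runs of an algorithm against the adversary.

-- The answers are arbitrary and only the queries must be those of `alg`, so the orientation can be
-- fixed afterwards.
data Reached (alg : Algorithm n) : Transcript n → Set where
  start : Reached alg []
  query : ∀ {h v w} → Reached alg h → alg h ≡ evaluate v → Reached alg ((v , w) ∷ h)

Consistent : Outmap n → Transcript n → Set
Consistent o = All (λ (v , w) → w ≡ o v)

-- An action depends on the transcript alone, so a run on any orientation that fits the answers in
-- `h` must pass through `h`.
resume : ∀ {alg : Algorithm n} {o h k w} → Reached alg h → Consistent o h →
         Run alg o [] k w → ∃[ j ] k ≡ length h + j × Run alg o h j w
resume {k = k} start [] run = k , refl , run
resume (query reached asks) (refl ∷ con) run with resume reached con run
... | _ , _  , halt returns = contradiction (trans (sym asks) returns) λ ()
... | _ , eq , step {k = j} asks′ run′ with trans (sym asks) asks′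
...   | refl = j , trans eq (ℕₚ.+-suc _ j) , run′

halted : ∀ {alg : Algorithm n} {o h w} → Reached alg h → Consistent o h → alg h ≡ return w →
         ∃[ k ] FindsSinkWith alg o k → IsSink o w
halted reached con returns (_ , w′ , run , sink) with resume reached con run
... | _ , _ , step asks _ = contradiction (trans (sym asks) returns) λ ()
... | _ , _ , halt returns′ with trans (sym returns) returns′
...   | refl = sink

record State (alg : Algorithm n) (h : Transcript n) (m : ℕ) : Set where
  field
    forest     : Forest n
    tails      : List (Fin n)
    size       : m ≤ length tails
    separated  : Separated forest tails
    vanishing  : All (λ (v , _) → All (Vanishes forest v) tails) h
    reached    : Reached alg h
    consistent : Consistent (orientation forest) h

sink⇒path : (F : Forest n) {w : Vertex n} → IsSink (orientation F) w →
            ∀ i → lookup (pathXor F w) i ≡ true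
sink⇒path F {w} sink i = not-injective (begin
  not (lookup (pathXor F w) i)   ≡⟨ lookup-map i not (pathXor F w) ⟨
  lookup (orientation F w) i     ≡⟨ cong (λ u → lookup u i) sink ⟩
  lookup (replicate _ false) i   ≡⟨ lookup-replicate i false ⟩
  false                          ∎)
  where open ≡-Reasoning

module _ {alg : Algorithm n} (finds : FindsRealizableMatoušekSinks alg) where

  -- Attaching the first tree below the second tail contradicts no answer so far but moves the sink.
  cannotReturn : ∀ {h w m} → 2 ≤ m → State alg h m → alg h ≢ return w
  cannotReturn {h} {w} 2≤m S returns = conflict tails (ℕₚ.≤-trans 2≤m size) separated vanishing
    where
    open State S
    sinkOf : ∀ F → Consistent (orientation F) h → ∀ i → lookup (pathXor F w) i ≡ true
    sinkOf F con = sink⇒path F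
      (halted reached con returns (finds (orientation F) (orientation-isRealizableMatoušek F)))

    conflict : ∀ ts → 2 ≤ length ts → Separated forest ts →
               ¬ All (λ (v , _) → All (Vanishes forest v) ts) h
    conflict (x ∷ [])    (s≤s ())
    conflict (x ∷ y ∷ _) _ ((x<y ∷ _) ∷ _) vanish =
      contradiction
        (begin
          true
            ≡⟨ sinkOf attached consistent′ x ⟨
          lookup (pathXor attached w) x
            ≡⟨ pathXor-attach-tree forest w x<y (root-idem forest x) refl ⟩
          lookup (pathXor forest w) x xor lookup (pathXor forest w) y
            -- `w` would be the sink for both forests, so all three xors would be 1; but 1 xor 1 =
            -- 0.
            ≡⟨ cong₂ _xor_ (sinkOf forest consistent x) (sinkOf forest consistent y) ⟩
          false ∎)
        λ ()
      where
      open ≡-Reasoning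
      attached = attach forest (root forest x) y
      consistent′ : Consistent (orientation attached) h
      consistent′ = All.zipWith
        (λ { {v , _} (w≡ , _ ∷ y≡0 ∷ _) →
          trans w≡ (cong (map not) (sym (pathXor-attach-vanishing forest v (root-idem forest x) y≡0))) })
        (consistent , vanish)

  initial : State alg [] n
  initial = record
    { forest     = discrete n
    ; tails      = allFin n
    ; size       = ℕₚ.≤-reflexive (sym (length-tabulate id))
    ; separated  = AllPairsₚ.tabulate⁺-< λ {i} → subst (Fin._< _) (sym (root-discrete i))
    ; vanishing  = []
    ; reached    = start
    ; consistent = []
    }

  answer : ∀ {h v m} → alg h ≡ evaluate v → State alg h (3 * m) → ∃[ e ] State alg (e ∷ h) m
  -- The query is answered from the refined forest, which still gives all earlier answers by
  -- `agree`.
  answer {v = v} {m} asks S = (v , orientation F′ v) , record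
    { forest     = F′
    ; tails      = ts′
    ; size       = R.size
    ; separated  = R.separated
    ; vanishing  = R.vanishing ∷ All.map
        (λ {(u , _)} zeros → subst (λ w → All (λ t → lookup w t ≡ false) ts′) (sym (R.agree u zeros)) (R.subset zeros))
        vanishing
    ; reached    = query reached asks
    ; consistent = refl ∷ All.zipWith
        (λ { {u , _} (w≡ , zeros) → trans w≡ (cong (map not) (sym (R.agree u zeros))) })
        (consistent , vanishing)
    }
    where
    open State S
    module R = Refinement (refine forest v m size separated)
    open R using (F′; ts′)

  -- The action alg h is an argument since with-abstracting it would normalise the type of finds.
  advance : ∀ {h m} a → alg h ≡ a → 2 ≤ 3 * m → State alg h (3 * m) → ∃[ e ] State alg (e ∷ h) m
  advance (return w)   returns 2≤3m S = contradiction returns (cannotReturn 2≤3m S)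
  advance (evaluate v) asks    _    S = answer asks S

  -- Each round divides the bound on the tails by three, from 3^K * 2 down to 2. It is at least two
  -- before every round, so the algorithm cannot stop earlier.
  play : ∀ K {h} → State alg h (3 ^ K * 2) → ∃[ h′ ] length h′ ≡ K + length h × State alg h′ 2
  play zero    S = _ , refl , S
  play (suc K) {h} S =
    let e , S′ = advance (alg h) refl 2≤ (subst (State alg h) (ℕₚ.*-assoc 3 (3 ^ K) 2) S)
        h′ , len , S″ = play K S′
    in h′ , trans len (ℕₚ.+-suc K (length h)) , S″
    where
    2≤ : 2 ≤ 3 * (3 ^ K * 2)
    2≤ = ℕₚ.*-mono-≤ (s≤s (z≤n {2})) (ℕₚ.m≤n*m 2 (3 ^ K) {{ℕₚ.m^n≢0 3 K}})

  -- `finds` supplies a halting run on `o`, and by `resume` this run makes all the evaluations in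
  -- `h`.
  atLeast : ∀ {h o} → Reached alg h → Consistent o h → IsRealizableMatoušek o →
            ∃[ o ] ∃[ k ] IsRealizableMatoušek o × FindsSinkWith alg o k × length h ≤ k
  atLeast {h} {o} reached con realizable =
    let k , w , run , sink = finds o realizable
        j , k≡ , _ = resume reached con run
    in o , k , realizable , (w , run , sink) ,
       ℕₚ.≤-trans (ℕₚ.m≤m+n (length h) j) (ℕₚ.≤-reflexive (sym k≡))

  manyEvaluations : ∀ K → 3 ^ K * 2 ≤ n →
    ∃[ o ] ∃[ k ] IsRealizableMatoušek o × FindsSinkWith alg o k × K ≤ k
  manyEvaluations K 3^K*2≤n =
    let h , len , S = play K (record { State initial ; size = ℕₚ.≤-trans 3^K*2≤n (State.size initial) })
        o , k , realizable , found , h≤k =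
          atLeast (State.reached S) (State.consistent S) (orientation-isRealizableMatoušek (State.forest S))
    in o , k , realizable , found , subst (_≤ k) (trans len (ℕₚ.+-identityʳ K)) h≤k

-- Arithmetic of the logarithmic bound.

-- A search downwards from `j` for the K with 2 * 4^K ≤ n < 2 * 4^(K+1); since n ≥ 8 = 2 * 4, it
-- stops at some K ≥ 1. Base 4 replaces 3 to give powers of two, whose logarithms are exact.
between-4^ : ∀ j n → 8 ≤ n → n < 2 ^ (1 + 2 * suc j) →
       ∃[ K ] 1 ≤ K × 2 ^ (1 + 2 * K) ≤ n × n < 2 ^ (1 + 2 * suc K)
between-4^ zero    n 8≤n n< = contradiction 8≤n (ℕₚ.<⇒≱ n<)
between-4^ (suc j) n 8≤n n< with 2 ^ (1 + 2 * suc j) ≤? n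
... | yes ≤n = suc j , s≤s z≤n , ≤n , n<
... | no  ≰n = between-4^ j n 8≤n (ℕₚ.≰⇒> ≰n)

n<2^n : ∀ n → n < 2 ^ n
n<2^n zero    = z<s
n<2^n (suc n) = ℕₚ.≤-trans (ℕₚ.+-mono-≤ (ℕₚ.m^n>0 2 n) (n<2^n n))
                  (ℕₚ.≤-reflexive (cong (2 ^ n +_) (sym (ℕₚ.+-identityʳ (2 ^ n)))))

theorem24 : ∃[ C ] ∃[ N ] 0 < C ×
    (∀ n → N ≤ n → (alg : Algorithm n) → FindsRealizableMatoušekSinks alg →
    ∃[ o ] ∃[ k ] IsRealizableMatoušek o × FindsSinkWith alg o k × ⌈log₂ n ⌉ ≤ C * k)
-- The threshold 8 ensures K ≥ 1, and then the logarithm is at most 3 + 2K ≤ 5K, whence the constant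
-- 5.
theorem24 = 5 , 8 , z<s , λ n 8≤n alg finds →
  let K , 1≤K , ≤n , n< = between-4^ n n 8≤n (ℕₚ.<-≤-trans (n<2^n n) (ℕₚ.^-monoʳ-≤ 2 (n≤ n)))
      o , k , realizable , found , K≤k = manyEvaluations finds K (ℕₚ.≤-trans (3^K*2≤ K) ≤n)
  in o , k , realizable , found , (begin
    ⌈log₂ n ⌉                       ≤⟨ ⌈log₂⌉-mono-≤ (ℕₚ.<⇒≤ n<) ⟩
    ⌈log₂ 2 ^ (1 + 2 * suc K) ⌉     ≡⟨ ⌈log₂2^n⌉≡n (1 + 2 * suc K) ⟩
    1 + 2 * suc K                   ≡⟨ cong suc (ℕₚ.*-suc 2 K) ⟩
    3 + 2 * K                       ≤⟨ ℕₚ.+-monoˡ-≤ (2 * K) (ℕₚ.*-monoʳ-≤ 3 1≤K) ⟩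
    3 * K + 2 * K                   ≡⟨ ℕₚ.*-distribʳ-+ K 3 2 ⟨
    5 * K                           ≤⟨ ℕₚ.*-monoʳ-≤ 5 K≤k ⟩
    5 * k                           ∎)
  where
  open ℕₚ.≤-Reasoning
  n≤ : ∀ n → n ≤ 1 + 2 * suc n
  n≤ n = ℕₚ.≤-trans (ℕₚ.n≤1+n n) (ℕₚ.≤-trans (ℕₚ.m≤n*m (suc n) 2) (ℕₚ.n≤1+n (2 * suc n)))
  3^K*2≤ : ∀ K → 3 ^ K * 2 ≤ 2 ^ (1 + 2 * K)
  3^K*2≤ K = begin
    3 ^ K * 2         ≤⟨ ℕₚ.*-monoˡ-≤ 2 (ℕₚ.^-monoˡ-≤ K (ℕₚ.n≤1+n 3)) ⟩
    4 ^ K * 2         ≡⟨ ℕₚ.*-comm (4 ^ K) 2 ⟩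
    2 * 4 ^ K         ≡⟨ cong (2 *_) (ℕₚ.^-*-assoc 2 2 K) ⟩
    2 ^ (1 + 2 * K)   ∎
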